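{- Let $(G,c,r)$ be an instance of the metric Many-Visits TSP and let $\alpha\geq1$. Let $T_1$ be a Hamiltonian cycle in $G$ (a single-visit TSP tour) with $c(T_1)\leq\alpha\cdot c(\mathrm{OPT}_1)$, where $\mathrm{OPT}_1$ is an optimal single-visit tour, and let $P\in\mathbb{Z}_{\geq0}^E$ be an optimal solution of the transportation problem with prescriptions $r-1$, i.e. a minimum-cost $P$ with $d_P(v)=2(r(v)-1)$ for all $v\in V$. Then the multigraph $T=T_1+P$ is a feasible solution of the Many-Visits TSP instance $(G,c,r)$, and $c(T)\leq(\alpha+1)\cdot c(\mathrm{OPT}_r)$, where $\mathrm{OPT}_r$ is an optimal Many-Visits TSP solution for $(G,c,r)$.
   Context: $G=(V,E)$ is the complete undirected graph on $n$ vertices with a self-loop at each vertex; $d_x(v)$ is the sum of $x$-values of edges incident to $v$, the self-loop counted twice. Costs $c:E\to\mathbb{R}_{\geq0}$ satisfy the triangle inequality, including $c(vv)\leq 2c(uv)$ for all $u,v$. A feasible Many-Visits TSP solution for requests $r:V\to\mathbb{Z}_{\geq1}$ is $z\in\mathbb{Z}_{\geq0}^E$ with $d_z(v)=2r(v)$ for all $v$ and $(V,\mathrm{supp}(z))$ connected; its cost is $\sum_e c(e)z(e)$. The transportation problem with prescriptions $q:V\to\mathbb{Z}_{\geq0}$ asks for a minimum-cost $z\in\mathbb{Z}_{\geq0}^E$ with $d_z(v)=2q(v)$ for all $v$ (no connectivity). For multigraphs $H_1,H_2$ on $V$, $H_1+H_2$ is the union of their edge multisets. -}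

module Defs where

open import Level using (Level; _⊔_) renaming (suc to lsuc)
open import Algebra.Bundles using (CommutativeRing)
open import Algebra.Properties.CommutativeMonoid.Sum as Sum using ()
open import Algebra.Properties.Monoid.Mult as Mult using ()
open import Data.Bool.Base using (if_then_else_)
open import Data.Fin.Base using (Fin)
open import Data.Fin.Properties using (_≟_; _≤?_)
open import Data.List.Base using (List; []; _∷_; [_]; _++_; length; filter; zip)
open import Data.List.Membership.Propositional using (_∈_)
open import Data.List.Properties using (filter-≐)
open import Data.List.Relation.Unary.Unique.Propositional using (Unique)
open import Data.Nat.Base as ℕ using (ℕ)
open import Data.Nat.Properties using (+-0-commutativeMonoid)
open import Data.Product.Base using (_×_; _,_; ∃)
open import Data.Sum.Base using (_⊎_; swap)
open import Relation.Binary.Construct.Closure.ReflexiveTransitive using (Star)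
open import Relation.Binary.Core using (Rel)
open import Relation.Binary.PropositionalEquality using (_≡_; cong; cong₂)
open import Relation.Binary.Structures using (IsPartialOrder)
open import Relation.Nullary.Decidable using (Dec; does; _×-dec_; _⊎-dec_)

-- The standard library has no real numbers, so costs live in an arbitrary
-- ordered commutative ring. Totality of the order and inverses are not
-- required, so the axioms hold for ℝ classically and constructively alike
-- (constructively, the order on ℝ is not total).
record OrderedCommutativeRing (a ℓ₁ ℓ₂ : Level) : Set (lsuc (a ⊔ ℓ₁ ⊔ ℓ₂)) where
  infix 4 _≤_
  field
    commutativeRing : CommutativeRing a ℓ₁
  open CommutativeRing commutativeRing public
  field
    _≤_            : Rel Carrier ℓ₂
    isPartialOrder : IsPartialOrder _≈_ _≤_
    +-mono-≤       : ∀ {x y u v} → x ≤ y → u ≤ v → x + u ≤ y + v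
    *-nonNegative  : ∀ {x y} → 0# ≤ x → 0# ≤ y → 0# ≤ x * y
    0≤1            : 0# ≤ 1#

-- Functions on the edge set E of the complete graph with self-loops on Fin n
-- are represented as symmetric functions of two, possibly equal, endpoints.
record Multigraph (n : ℕ) : Set where
  field
    mult     : Fin n → Fin n → ℕ
    mult-sym : ∀ u v → mult u v ≡ mult v u

open Multigraph public

private
  variable
    n : ℕ

infixl 6 _⊕_
_⊕_ : Multigraph n → Multigraph n → Multigraph n
(H₁ ⊕ H₂) .mult u v     = mult H₁ u v ℕ.+ mult H₂ u v
(H₁ ⊕ H₂) .mult-sym u v = cong₂ ℕ._+_ (mult-sym H₁ u v) (mult-sym H₂ u v)

-- The sum contains the self-loop at v once; the last summand is its second
-- occurrence.
degree : Multigraph n → Fin n → ℕ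
degree z v = Sum.sum +-0-commutativeMonoid (λ u → mult z v u) ℕ.+ mult z v v

Adjacent : Multigraph n → Fin n → Fin n → Set
Adjacent z u v = 0 ℕ.< mult z u v

Connected : Multigraph n → Set
Connected {n} z = (u v : Fin n) → Star (Adjacent z) u v

IsTransportation : (Fin n → ℕ) → Multigraph n → Set
IsTransportation {n} q z = (v : Fin n) → degree z v ≡ 2 ℕ.* q v

IsManyVisitsTour : (Fin n → ℕ) → Multigraph n → Set
IsManyVisitsTour {n} r z = ((v : Fin n) → degree z v ≡ 2 ℕ.* r v) × Connected z

SameEdge : Fin n × Fin n → Fin n × Fin n → Set
SameEdge (u , v) (a , b) = (u ≡ a × v ≡ b) ⊎ (v ≡ a × u ≡ b)

sameEdge? : (e f : Fin n × Fin n) → Dec (SameEdge e f)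
sameEdge? (u , v) (a , b) = (u ≟ a ×-dec v ≟ b) ⊎-dec (v ≟ a ×-dec u ≟ b)

fromEdges : List (Fin n × Fin n) → Multigraph n
fromEdges es .mult u v     = length (filter (sameEdge? (u , v)) es)
fromEdges es .mult-sym u v =
  cong length (filter-≐ (sameEdge? (u , v)) (sameEdge? (v , u)) (swap , swap) es)

cyclicEdges : List (Fin n) → List (Fin n × Fin n)
cyclicEdges []       = []
cyclicEdges (v ∷ vs) = zip (v ∷ vs) (vs ++ [ v ])

-- For n = 1 this is the self-loop, for n = 2 the doubled edge.
IsHamiltonianCycle : Multigraph n → Set
IsHamiltonianCycle {n} z = ∃ λ (vs : List (Fin n)) →
  Unique vs × ((v : Fin n) → v ∈ vs) ×
  ((u v : Fin n) → mult z u v ≡ mult (fromEdges (cyclicEdges vs)) u v)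

module _ {a ℓ₁ ℓ₂ : Level} (K : OrderedCommutativeRing a ℓ₁ ℓ₂) where
  open OrderedCommutativeRing K

  -- In the triangle inequality u, v, w need not be distinct: taking u = w
  -- bounds the self-loop, c u u ≤ c u v + c v u = 2 c(uv).
  record MetricCost (n : ℕ) : Set (a ⊔ ℓ₁ ⊔ ℓ₂) where
    field
      edgeCost    : Fin n → Fin n → Carrier
      symmetric   : ∀ u v → edgeCost u v ≈ edgeCost v u
      nonNegative : ∀ u v → 0# ≤ edgeCost u v
      triangle    : ∀ u v w → edgeCost u w ≤ edgeCost u v + edgeCost v w

module _ {a ℓ₁ ℓ₂ : Level} {K : OrderedCommutativeRing a ℓ₁ ℓ₂} where
  open OrderedCommutativeRing K
  open MetricCost

  -- Each edge has exactly one representative (u , v) with u ≤ v.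
  cost : MetricCost K n → Multigraph n → Carrier
  cost c z = ∑ λ u → ∑ λ v →
    if does (u ≤? v) then mult z u v · edgeCost c u v else 0#
    where
    open Sum +-commutativeMonoid using () renaming (sum to ∑)
    open Mult +-monoid using () renaming (_×_ to _·_)

  IsOptimal : MetricCost K n → (Multigraph n → Set) → Multigraph n → Set ℓ₂
  IsOptimal {n} c Feasible z =
    Feasible z × ((z′ : Multigraph n) → Feasible z′ → cost c z ≤ cost c z′)

{-# OPTIONS --safe #-}

-- OPTᵣ is connected with even degrees, so it has an Euler tour, a cyclic
-- sequence visiting each v exactly r v times. Keeping one visit of each vertex
-- gives a Hamiltonian cycle, and keeping the other r v ∸ 1 visits gives a
-- transportation solution. By the triangle inequality neither shortcut costs
-- more than OPTᵣ, so cost OPT₁ ≤ cost OPTᵣ and cost P ≤ cost OPTᵣ.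
module Submission where

open import Defs
open import Algebra.Bundles using (CommutativeMonoid)
open import Algebra.Properties.CommutativeMonoid.Sum as Sum using ()
open import Algebra.Properties.CommutativeSemigroup as CommutativeSemigroupProperties using ()
open import Algebra.Properties.Monoid.Mult as Mult using ()
open import Data.Bool.Base using (true; false; if_then_else_)
open import Data.Fin.Base using (Fin; zero; suc; punchIn) renaming (_≤_ to _≤ᶠ_)
open import Data.Fin.Properties using (_≟_; _≤?_; punchInᵢ≢i; ¬∀⟶∃¬) renaming (≤-antisym to ≤ᶠ-antisym; ≤-total to ≤ᶠ-total)
open import Data.List.Base using (List; []; _∷_; [_]; _++_; map; zip; filter; length)
open import Data.List.Membership.Propositional using (_∈_; find)
open import Data.List.Membership.Propositional.Properties using (∈-∃++; ∈-++⁺ʳ)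
open import Data.List.Membership.DecPropositional as Mem using ()
open import Data.List.Properties using (filter-++; filter-accept; filter-reject; length-++)
open import Data.List.Relation.Unary.Any using (here; there; any?)
open import Data.List.Relation.Unary.All using (lookup)
open import Data.List.Relation.Unary.All.Properties using (¬Any⇒All¬)
open import Data.List.Relation.Unary.Unique.Propositional using (Unique; []; _∷_)
open import Data.List.Relation.Binary.Sublist.Propositional using (_⊆_; []; _∷_; _∷ʳ_)
open import Data.Nat.Base as ℕ using (ℕ; zero; suc; _<_; _∸_; z≤n; s≤s)
open import Data.Nat.Divisibility using (_∣_; divides; ∣m+n∣m⇒∣n; m∣m*n; ∣1⇒≡1)
open import Data.Nat.Induction using (Acc; acc; <-wellFounded)
open import Data.Nat.ListAction using (sum)
open import Data.Nat.Properties using (+-0-commutativeMonoid; +-commutativeSemigroup; n≢0⇒n>0; n>0⇒n≢0; m+[n∸m]≡n; m<n+m; +-cancelʳ-≡; m+n≡0⇒m≡0; m≤m+n; ≤-trans; ≤-reflexive; +-identityʳ; +-assoc; +-comm; n≤0⇒n≡0; m≤n+m; *-cancelˡ-≡; *-distribˡ-+) renaming (_≟_ to _≟ℕ_)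
open import Data.Nat.Tactic.RingSolver using (solve-∀)
open import Data.Product.Base using (_×_; _,_; ∃; ∃₂)
open import Data.Sum.Base using (inj₁; inj₂)
open import Function.Base using (_∘_)
open import Level using (Level)
open import Relation.Binary.Construct.Closure.ReflexiveTransitive using (Star; ε; _◅_; _◅◅_; reverse) renaming (map to mapStar)
open import Relation.Binary.Bundles using (Poset)
open import Relation.Binary.PropositionalEquality using (_≡_; _≢_; refl; sym; trans; cong; cong₂; subst; subst₂; module ≡-Reasoning)
open import Relation.Nullary using (Dec; ¬_; yes; no; contradiction; ¬?)
open import Relation.Nullary.Decidable using (does; decidable-stable)

private
  variable
    n : ℕ

-- Finite sums with at most one nonzero term.

module _ {a ℓ} (M : CommutativeMonoid a ℓ) where
  open CommutativeMonoid M using (Carrier; _≈_) renaming (ε to 0#; trans to ≈-trans; ∙-congˡ to +-congˡ; identityʳ to +-identity)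
  open Sum M using (sum-cong-≋; sum-replicate-zero; sum-remove) renaming (sum to ∑)

  sum-zero : (f : Fin n → Carrier) → (∀ i → f i ≈ 0#) → ∑ f ≈ 0#
  sum-zero {n} f f≈0 = ≈-trans (sum-cong-≋ f≈0) (sum-replicate-zero n)

  sum-single : (f : Fin n → Carrier) (i : Fin n) → (∀ j → j ≢ i → f j ≈ 0#) → ∑ f ≈ f i
  sum-single {suc n} f i f≈0 =
    ≈-trans (sum-remove {i = i} f)
      (≈-trans (+-congˡ (sum-zero (f ∘ punchIn i) λ j → f≈0 _ (punchInᵢ≢i i j))) (+-identity _))

open Sum +-0-commutativeMonoid using (sum-cong-≗; ∑-distrib-+; sum-remove) renaming (sum to ∑)
open CommutativeSemigroupProperties +-commutativeSemigroup using (interchange; x∙yz≈y∙xz)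

term≤sum : (f : Fin n → ℕ) (i : Fin n) → f i ℕ.≤ ∑ f
term≤sum {suc n} f i = subst (f i ℕ.≤_) (sym (sum-remove {i = i} f)) (m≤m+n _ _)

-- Multigraphs up to pointwise equality, and degrees.

infix 4 _≋_
-- Pointwise, because propositional equality of these records would require function extensionality.
_≋_ : Multigraph n → Multigraph n → Set
z ≋ z′ = ∀ u v → mult z u v ≡ mult z′ u v

-- Encoded through `fromEdges`, so that `fromEdges-++` with a one-element list splits off the first
-- edge of a list.
edge : Fin n → Fin n → Multigraph n
edge a b = fromEdges [ a , b ]

mult-edge-yes : ∀ (u v : Fin n) {a b} → SameEdge (u , v) (a , b) → mult (edge a b) u v ≡ 1
mult-edge-yes u v same = cong length (filter-accept (sameEdge? (u , v)) same)

mult-edge-no : ∀ (u v : Fin n) {a b} → ¬ SameEdge (u , v) (a , b) → mult (edge a b) u v ≡ 0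
mult-edge-no u v ¬same = cong length (filter-reject (sameEdge? (u , v)) ¬same)

fromEdges-++ : (es fs : List (Fin n × Fin n)) → fromEdges (es ++ fs) ≋ fromEdges es ⊕ fromEdges fs
fromEdges-++ es fs u v =
  trans (cong length (filter-++ (sameEdge? (u , v)) es fs)) (length-++ (filter (sameEdge? (u , v)) es))

degree-cong : {z z′ : Multigraph n} → z ≋ z′ → ∀ v → degree z v ≡ degree z′ v
degree-cong z≋z′ v = cong₂ ℕ._+_ (sum-cong-≗ (z≋z′ v)) (z≋z′ v v)

degree-⊕ : (z z′ : Multigraph n) → ∀ v → degree (z ⊕ z′) v ≡ degree z v ℕ.+ degree z′ v
degree-⊕ z z′ v = trans
  (cong (ℕ._+ (mult z v v ℕ.+ mult z′ v v)) (∑-distrib-+ (mult z v) (mult z′ v)))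
  (interchange (∑ (mult z v)) (∑ (mult z′ v)) (mult z v v) (mult z′ v v))

mult≤degree : (z : Multigraph n) → ∀ u v → mult z u v ℕ.≤ degree z u
mult≤degree z u v = ≤-trans (term≤sum (mult z u) v) (m≤m+n _ _)

δ : Fin n → Fin n → ℕ
δ u v = if does (u ≟ v) then 1 else 0

δ-refl : (v : Fin n) → δ v v ≡ 1
δ-refl v with v ≟ v
... | yes _  = refl
... | no v≢v = contradiction refl v≢v

δ-≢ : {u v : Fin n} → u ≢ v → δ u v ≡ 0
δ-≢ {u = u} {v} u≢v with u ≟ v
... | yes u≡v = contradiction u≡v u≢v
... | no _    = refl

-- A self-loop yields 2: one unit from the sum in `degree`, one from its extra diagonal summand.
-- Otherwise at most one neighbour contributes.
degree-edge : (a b v : Fin n) → degree (edge a b) v ≡ δ a v ℕ.+ δ b v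
degree-edge a b v with a ≟ v | b ≟ v
... | yes refl | yes refl = cong₂ ℕ._+_
  (trans (sum-single +-0-commutativeMonoid (mult (edge a a) a) a λ u u≢a →
            mult-edge-no a u λ { (inj₁ (_ , u≡a)) → u≢a u≡a ; (inj₂ (u≡a , _)) → u≢a u≡a })
         (mult-edge-yes a a (inj₁ (refl , refl))))
  (mult-edge-yes a a (inj₁ (refl , refl)))
... | yes refl | no b≢a = cong₂ ℕ._+_
  (trans (sum-single +-0-commutativeMonoid (mult (edge a b) a) b λ u u≢b →
            mult-edge-no a u λ { (inj₁ (_ , u≡b)) → u≢b u≡b ; (inj₂ (_ , a≡b)) → b≢a (sym a≡b) })
         (mult-edge-yes a b (inj₁ (refl , refl))))
  (mult-edge-no a a λ { (inj₁ (_ , a≡b)) → b≢a (sym a≡b) ; (inj₂ (_ , a≡b)) → b≢a (sym a≡b) })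
... | no a≢b | yes refl = cong₂ ℕ._+_
  (trans (sum-single +-0-commutativeMonoid (mult (edge a b) b) a λ u u≢a →
            mult-edge-no b u λ { (inj₁ (b≡a , _)) → a≢b (sym b≡a) ; (inj₂ (u≡a , _)) → u≢a u≡a })
         (mult-edge-yes b a (inj₂ (refl , refl))))
  (mult-edge-no b b λ { (inj₁ (b≡a , _)) → a≢b (sym b≡a) ; (inj₂ (b≡a , _)) → a≢b (sym b≡a) })
... | no a≢v | no b≢v = cong₂ ℕ._+_
  (sum-zero +-0-commutativeMonoid (mult (edge a b) v) λ u →
     mult-edge-no v u λ { (inj₁ (v≡a , _)) → a≢v (sym v≡a) ; (inj₂ (_ , v≡b)) → b≢v (sym v≡b) })
  (mult-edge-no v v λ { (inj₁ (v≡a , _)) → a≢v (sym v≡a) ; (inj₂ (_ , v≡b)) → b≢v (sym v≡b) })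

-- Edge removal and the termination measure.

remove-edge : (z : Multigraph n) {x y : Fin n} → 0 < mult z x y → ∃ λ z′ → z ≋ edge x y ⊕ z′
remove-edge z {x} {y} z>0 = z′ , λ u v → sym (m+[n∸m]≡n (edge≤z u v))
  where
  -- Makes the truncated subtraction in `z′` exact, at both orientations of the edge.
  edge≤z : ∀ u v → mult (edge x y) u v ℕ.≤ mult z u v
  edge≤z u v with sameEdge? (u , v) (x , y)
  ... | yes same = subst (ℕ._≤ mult z u v) (sym (mult-edge-yes u v same)) (z>0′ same)
    where
    z>0′ : SameEdge (u , v) (x , y) → 0 < mult z u v
    z>0′ (inj₁ (refl , refl)) = z>0
    z>0′ (inj₂ (refl , refl)) = subst (0 <_) (mult-sym z x y) z>0
  ... | no ¬same = subst (ℕ._≤ mult z u v) (sym (mult-edge-no u v ¬same)) z≤n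
  z′ : Multigraph _
  z′ .mult u v     = mult z u v ∸ mult (edge x y) u v
  z′ .mult-sym u v = cong₂ _∸_ (mult-sym z u v) (mult-sym (edge x y) u v)

-- If all multiplicities at x vanished, so would the degree; a search through the finite vertex set
-- produces the witness.
neighbour : (z : Multigraph n) {x : Fin n} → degree z x ≢ 0 → ∃ λ y → 0 < mult z x y
neighbour {n} z {x} d≢0
  with y , m≢0 ← ¬∀⟶∃¬ n (λ y → mult z x y ≡ 0) (λ y → mult z x y ≟ℕ 0)
                  (λ m≡0 → d≢0 (cong₂ ℕ._+_ (sum-zero +-0-commutativeMonoid (mult z x) m≡0) (m≡0 x)))
  = y , n≢0⇒n>0 m≢0

-- Twice the number of edges. It drops whenever an edge is used up, which makes `walk` and
-- `hierholzer` terminate.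
size : Multigraph n → ℕ
size z = ∑ (degree z)

size-≋⊕ : {z : Multigraph n} (z₁ z₂ : Multigraph n) → z ≋ z₁ ⊕ z₂ → size z ≡ size z₁ ℕ.+ size z₂
size-≋⊕ {z = z} z₁ z₂ eq = trans
  (sum-cong-≗ λ v → trans (degree-cong {z = z} {z₁ ⊕ z₂} eq v) (degree-⊕ z₁ z₂ v))
  (∑-distrib-+ (degree z₁) (degree z₂))

size-edge : (a b : Fin n) → 0 < size (edge a b)
size-edge a b = ≤-trans
  (subst (0 <_) (sym (trans (degree-edge a b a) (cong (ℕ._+ δ b a) (δ-refl a)))) (s≤s z≤n))
  (term≤sum (degree (edge a b)) a)

-- Walks as vertex lists, and their degrees.

visits : Fin n → List (Fin n) → ℕ
visits v l = sum (map (λ u → δ u v) l)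

headOr : Fin n → List (Fin n) → Fin n
headOr t []      = t
headOr t (x ∷ _) = x

-- The endpoint t of the walk is not listed, so that a closed walk lists it once.
walkEdges : List (Fin n) → Fin n → List (Fin n × Fin n)
walkEdges []      t = []
walkEdges (x ∷ l) t = (x , headOr t l) ∷ walkEdges l t

zip-walkEdges : (x : Fin n) (l : List (Fin n)) (t : Fin n) → zip (x ∷ l) (l ++ [ t ]) ≡ walkEdges (x ∷ l) t
zip-walkEdges x []      t = refl
zip-walkEdges x (y ∷ l) t = cong ((x , y) ∷_) (zip-walkEdges y l t)

-- The first piece has to end where the second one begins, hence its endpoint `headOr t m`.
walkEdges-++ : (l m : List (Fin n)) (t : Fin n) →
  walkEdges (l ++ m) t ≡ walkEdges l (headOr t m) ++ walkEdges m t
walkEdges-++ []          m t = refl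
walkEdges-++ (x ∷ [])    m t = refl
walkEdges-++ (x ∷ y ∷ l) m t = cong ((x , y) ∷_) (walkEdges-++ (y ∷ l) m t)

cyclicEdges-∷ : (x : Fin n) (l : List (Fin n)) → cyclicEdges (x ∷ l) ≡ walkEdges (x ∷ l) x
cyclicEdges-∷ x l = zip-walkEdges x l x

degree-∷ : (a b : Fin n) (es : List (Fin n × Fin n)) (v : Fin n) →
  degree (fromEdges ((a , b) ∷ es)) v ≡ δ a v ℕ.+ δ b v ℕ.+ degree (fromEdges es) v
degree-∷ a b es v = trans
  (degree-cong {z = fromEdges ((a , b) ∷ es)} {edge a b ⊕ fromEdges es} (fromEdges-++ [ a , b ] es) v)
  (trans (degree-⊕ (edge a b) (fromEdges es) v) (cong (ℕ._+ degree (fromEdges es) v) (degree-edge a b v)))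

degree-[] : (v : Fin n) → degree (fromEdges []) v ≡ 0
degree-[] v = cong (ℕ._+ 0) (sum-zero +-0-commutativeMonoid (λ u → mult (fromEdges []) v u) λ _ → refl)

-- Every listed visit is entered and left, except that the head is not entered, while the unlisted t
-- is entered once. The head's indicator stands on the left to avoid subtraction; for a closed walk
-- the two indicators cancel.
degree-walk : (l : List (Fin n)) (t v : Fin n) →
  degree (fromEdges (walkEdges l t)) v ℕ.+ δ (headOr t l) v ≡ 2 ℕ.* visits v l ℕ.+ δ t v
degree-walk []      t v = cong (ℕ._+ δ t v) (degree-[] v)
degree-walk (x ∷ l) t v = begin
  degree (fromEdges (walkEdges (x ∷ l) t)) v ℕ.+ δ x v  ≡⟨ cong (ℕ._+ δ x v) (degree-∷ x _ (walkEdges l t) v) ⟩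
  δ x v ℕ.+ δ h v ℕ.+ d ℕ.+ δ x v                       ≡⟨ regroup (δ x v) (δ h v) d ⟩
  2 ℕ.* δ x v ℕ.+ (d ℕ.+ δ h v)                         ≡⟨ cong (2 ℕ.* δ x v ℕ.+_) (degree-walk l t v) ⟩
  2 ℕ.* δ x v ℕ.+ (2 ℕ.* visits v l ℕ.+ δ t v)          ≡⟨ collect (δ x v) (visits v l) (δ t v) ⟩
  2 ℕ.* (δ x v ℕ.+ visits v l) ℕ.+ δ t v                ∎
  where
  open ≡-Reasoning
  h = headOr t l
  d = degree (fromEdges (walkEdges l t)) v
  regroup : ∀ a b c → a ℕ.+ b ℕ.+ c ℕ.+ a ≡ 2 ℕ.* a ℕ.+ (c ℕ.+ b)
  regroup = solve-∀
  collect : ∀ a b c → 2 ℕ.* a ℕ.+ (2 ℕ.* b ℕ.+ c) ≡ 2 ℕ.* (a ℕ.+ b) ℕ.+ c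
  collect = solve-∀

degree-cyclic : (l : List (Fin n)) (v : Fin n) → degree (fromEdges (cyclicEdges l)) v ≡ 2 ℕ.* visits v l
degree-cyclic []      v = degree-[] v
degree-cyclic (x ∷ l) v rewrite cyclicEdges-∷ x l = +-cancelʳ-≡ (δ x v) _ _ (degree-walk (x ∷ l) x v)

-- Closed walks from even degrees, and their splicing.

degree-≋edge⊕ : {z : Multigraph n} {x y : Fin n} (z′ : Multigraph n) → z ≋ edge x y ⊕ z′ →
  ∀ v → degree z v ≡ δ x v ℕ.+ δ y v ℕ.+ degree z′ v
degree-≋edge⊕ {z = z} {x} {y} z′ z≋ v = trans (degree-cong {z = z} {edge x y ⊕ z′} z≋ v)
  (trans (degree-⊕ (edge x y) z′ v) (cong (ℕ._+ degree z′ v) (degree-edge x y v)))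

odd⇒≢0 : {x s : Fin n} {d : ℕ} → x ≢ s → 2 ∣ δ x x ℕ.+ δ s x ℕ.+ d → d ≢ 0
odd⇒≢0 {x = x} x≢s even refl
  with () ← ∣1⇒≡1 (subst (2 ∣_) (cong (ℕ._+ 0) (cong₂ ℕ._+_ (δ-refl x) (δ-≢ (x≢s ∘ sym)))) even)

-- Parity invariant of `walk` along an edge xy, with a, b, c the indicators of x, s, y and d, e the
-- degrees before and after: the two sums differ by 2a.
even-step : ∀ a b c {d e} → d ≡ a ℕ.+ c ℕ.+ e → 2 ∣ a ℕ.+ b ℕ.+ d → 2 ∣ c ℕ.+ b ℕ.+ e
even-step a b c {e = e} refl even =
  ∣m+n∣m⇒∣n (subst (2 ∣_) (regroup a b c e) even) (m∣m*n a)
  where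
  regroup : ∀ a b c d → a ℕ.+ b ℕ.+ (a ℕ.+ c ℕ.+ d) ≡ 2 ℕ.* a ℕ.+ (c ℕ.+ b ℕ.+ d)
  regroup = solve-∀

≋-step : (x s : Fin n) (l : List (Fin n)) {z z₁ : Multigraph n} (z₂ : Multigraph n) →
  z ≋ edge x (headOr s l) ⊕ z₁ → z₁ ≋ fromEdges (walkEdges l s) ⊕ z₂ →
  z ≋ fromEdges (walkEdges (x ∷ l) s) ⊕ z₂
≋-step x s l z₂ z≋ z₁≋ u v
  rewrite z≋ u v | z₁≋ u v | fromEdges-++ [ x , headOr s l ] (walkEdges l s) u v =
  sym (+-assoc (mult (edge x (headOr s l)) u v) (mult (fromEdges (walkEdges l s)) u v) (mult z₂ u v))

-- A walk from x that uses up edges can only get stuck at s: adding an edge xs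
-- makes all degrees even, so x ≢ s has odd, hence nonzero, degree.
walk : (x s : Fin n) (z : Multigraph n) → Acc _<_ (size z) →
  (∀ v → 2 ∣ δ x v ℕ.+ δ s v ℕ.+ degree z v) →
  ∃₂ λ l z′ → headOr s l ≡ x × z ≋ fromEdges (walkEdges l s) ⊕ z′ × (∀ v → 2 ∣ degree z′ v)
walk x s z (acc rs) even with x ≟ s
-- The two indicators coincide and add up to an even number, so the remaining degrees are even
-- themselves.
... | yes refl = [] , z , refl , (λ u v → refl) , λ v →
  ∣m+n∣m⇒∣n (even v) (divides (δ x v) (double (δ x v)))
  where
  double : ∀ a → a ℕ.+ a ≡ a ℕ.* 2
  double = solve-∀
... | no x≢s
  with y , zxy>0 ← neighbour z {x} (odd⇒≢0 x≢s (even x))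
  with z₁ , z≋ ← remove-edge z zxy>0
  with l , z₂ , refl , z₁≋ , even₂ ← walk y s z₁
         (rs (subst (size z₁ <_) (sym (size-≋⊕ {z = z} (edge x y) z₁ z≋)) (m<n+m _ (size-edge x y))))
         (λ v → even-step (δ x v) (δ s v) (δ y v) (degree-≋edge⊕ {z = z} z₁ z≋ v) (even v))
  = x ∷ l , z₂ , refl , ≋-step x s l {z} {z₁} z₂ z≋ z₁≋ , even₂

-- `walk` from x to x would stop at once, so a first edge xy is removed by hand and a walk leads
-- from y back to x.
closed-walk : (x : Fin n) (z : Multigraph n) → (∀ v → 2 ∣ degree z v) → degree z x ≢ 0 →
  ∃₂ λ l z′ → z ≋ fromEdges (cyclicEdges (x ∷ l)) ⊕ z′ × (∀ v → 2 ∣ degree z′ v)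
closed-walk x z even d≢0
  with y , zxy>0 ← neighbour z {x} d≢0
  with z₁ , z≋ ← remove-edge z zxy>0
  with l , z₂ , refl , z₁≋ , even₂ ← walk y x z₁ (<-wellFounded _)
         -- Putting xy back restores the degrees of z, so the parity condition for y and x is the
         -- evenness of z.
         (λ v → subst (2 ∣_)
           (trans (degree-≋edge⊕ {z = z} z₁ z≋ v) (cong (ℕ._+ degree z₁ v) (+-comm (δ x v) (δ y v))))
           (even v))
  = l , z₂ ,
    subst (λ es → z ≋ fromEdges es ⊕ z₂) (sym (cyclicEdges-∷ x l)) (≋-step x x l {z} {z₁} z₂ z≋ z₁≋) ,
    even₂

-- A closed walk at x, spliced in just before an occurrence of x, leaves the other edges alone: what
-- precedes it still ends at x.
walkEdges-insert : (l p m : List (Fin n)) (x t : Fin n) →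
  fromEdges (walkEdges (l ++ (x ∷ p) ++ (x ∷ m)) t) ≋
  fromEdges (walkEdges (x ∷ p) x) ⊕ fromEdges (walkEdges (l ++ x ∷ m) t)
walkEdges-insert l p m x t u v
  rewrite walkEdges-++ l ((x ∷ p) ++ (x ∷ m)) t
        | walkEdges-++ (x ∷ p) (x ∷ m) t
        | walkEdges-++ l (x ∷ m) t
        | fromEdges-++ (walkEdges l x) (walkEdges (x ∷ p) x ++ walkEdges (x ∷ m) t) u v
        | fromEdges-++ (walkEdges (x ∷ p) x) (walkEdges (x ∷ m) t) u v
        | fromEdges-++ (walkEdges l x) (walkEdges (x ∷ m) t) u v
  = x∙yz≈y∙xz (μ (walkEdges l x)) (μ (walkEdges (x ∷ p) x)) (μ (walkEdges (x ∷ m) t))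
  where
  μ : List (Fin _ × Fin _) → ℕ
  μ es = mult (fromEdges es) u v

cyclicEdges-insert : (l p m : List (Fin n)) (x : Fin n) →
  fromEdges (cyclicEdges (l ++ (x ∷ p) ++ (x ∷ m))) ≋
  fromEdges (cyclicEdges (x ∷ p)) ⊕ fromEdges (cyclicEdges (l ++ x ∷ m))
-- The closing vertex is the head of the list: x if nothing precedes the splice, y otherwise.
cyclicEdges-insert [] p m x
  rewrite cyclicEdges-∷ x (p ++ x ∷ m) | cyclicEdges-∷ x p | cyclicEdges-∷ x m
  = walkEdges-insert [] p m x x
cyclicEdges-insert (y ∷ l) p m x
  rewrite cyclicEdges-∷ y (l ++ (x ∷ p) ++ (x ∷ m)) | cyclicEdges-∷ x p | cyclicEdges-∷ y (l ++ x ∷ m)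
  = walkEdges-insert (y ∷ l) p m x y

-- Visit counts and Euler tours.

visits-∉ : {v : Fin n} (l : List (Fin n)) → ¬ v ∈ l → visits v l ≡ 0
visits-∉ []      v∉l = refl
visits-∉ (x ∷ l) v∉l = cong₂ ℕ._+_ (δ-≢ (v∉l ∘ here ∘ sym)) (visits-∉ l (v∉l ∘ there))

visits-unique : {v : Fin n} {l : List (Fin n)} → Unique l → v ∈ l → visits v l ≡ 1
visits-unique {v = v} {x ∷ l} (x∉l ∷ _) (here refl) =
  cong₂ ℕ._+_ (δ-refl v) (visits-∉ l λ v∈l → lookup x∉l v∈l refl)
visits-unique (x∉l ∷ uniq) (there v∈l) = cong₂ ℕ._+_ (δ-≢ (lookup x∉l v∈l)) (visits-unique uniq v∈l)

private
  -- If v were missing from l, the closed walk would have no edge at v; as `z′` has none at u, the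
  -- edge uv could not occur in z.
  ∈-step : {z z′ : Multigraph n} (l : List (Fin n)) → z ≋ fromEdges (cyclicEdges l) ⊕ z′ →
    {u v : Fin n} → degree z′ u ≡ 0 → Adjacent z u v → v ∈ l
  ∈-step {z = z} {z′} l z≋ {u} {v} d≡0 zuv>0 = decidable-stable (Mem._∈?_ _≟_ v l) λ v∉l →
    n>0⇒n≢0 zuv>0 (trans (z≋ u v) (cong₂ ℕ._+_
      (n≤0⇒n≡0 (subst₂ ℕ._≤_ (mult-sym (fromEdges (cyclicEdges l)) v u)
        (trans (degree-cyclic l v) (cong (2 ℕ.*_) (visits-∉ l v∉l)))
        (mult≤degree (fromEdges (cyclicEdges l)) v u)))
      (n≤0⇒n≡0 (subst (mult z′ u v ℕ.≤_) d≡0 (mult≤degree z′ u v)))))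

-- Hierholzer: a closed walk that still meets an unused edge is extended by a
-- closed walk of unused edges; otherwise connectivity shows that it is spanning.
hierholzer : {z : Multigraph n} → Connected z → {w : Fin n} (l : List (Fin n)) → w ∈ l →
  (z′ : Multigraph n) → Acc _<_ (size z′) → z ≋ fromEdges (cyclicEdges l) ⊕ z′ → (∀ v → 2 ∣ degree z′ v) →
  ∃ λ l′ → z ≋ fromEdges (cyclicEdges l′)
hierholzer {z = z} conn {w} l w∈l z′ (acc rs) z≋ even
  with any? (λ x → ¬? (degree z′ x ≟ℕ 0)) l
... | yes unused
  with x , x∈l , d≢0 ← find unused
  with l₁ , l₂ , refl ← ∈-∃++ x∈l
  with p , z″ , z′≋ , even″ ← closed-walk x z′ even d≢0
  = hierholzer {z = z} conn (l₁ ++ (x ∷ p) ++ (x ∷ l₂)) (∈-++⁺ʳ l₁ (here refl)) z″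
      (rs (subst (size z″ <_) (sym (size-≋⊕ {z = z′} (fromEdges (cyclicEdges (x ∷ p))) z″ z′≋))
             (m<n+m _ nonempty)))
      (λ u v → trans (z≋ u v) (trans
        (cong (mult (fromEdges (cyclicEdges (l₁ ++ x ∷ l₂))) u v ℕ.+_) (z′≋ u v))
        (trans (regroup (mult (fromEdges (cyclicEdges (l₁ ++ x ∷ l₂))) u v)
                        (mult (fromEdges (cyclicEdges (x ∷ p))) u v) (mult z″ u v))
          (cong (ℕ._+ mult z″ u v) (sym (cyclicEdges-insert l₁ p l₂ x u v))))))
      even″
  where
  regroup : ∀ a b c → a ℕ.+ (b ℕ.+ c) ≡ b ℕ.+ a ℕ.+ c
  regroup = solve-∀
  nonempty : 0 < size (fromEdges (cyclicEdges (x ∷ p)))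
  nonempty = ≤-trans
    (subst (0 <_) (sym (trans (degree-cyclic (x ∷ p) x) (cong (λ d → 2 ℕ.* (d ℕ.+ visits x p)) (δ-refl x)))) (s≤s z≤n))
    (term≤sum (degree (fromEdges (cyclicEdges (x ∷ p)))) x)
-- The vertices of l are closed under adjacency, so every u lies on l and has no edge left in `z′`.
... | no ¬unused = l , λ u v → trans (z≋ u v) (trans
  (cong (mult (fromEdges (cyclicEdges l)) u v ℕ.+_)
    (n≤0⇒n≡0 (subst (mult z′ u v ℕ.≤_) (used (reach (conn w u) w∈l)) (mult≤degree z′ u v))))
  (+-identityʳ _))
  where
  used : ∀ {x} → x ∈ l → degree z′ x ≡ 0
  used x∈l = decidable-stable (_ ≟ℕ 0) (lookup (¬Any⇒All¬ l ¬unused) x∈l)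
  reach : ∀ {x v} → Star (Adjacent z) x v → x ∈ l → v ∈ l
  reach ε            x∈l = x∈l
  reach (xy ◅ steps) x∈l = reach steps (∈-step {z = z} {z′} l z≋ (used x∈l) xy)

euler-tour : (z : Multigraph n) → Connected z → (∀ v → 2 ∣ degree z v) → (∀ v → degree z v ≢ 0) →
  ∃ λ l → z ≋ fromEdges (cyclicEdges l)
euler-tour {zero}  z conn even d≢0 = [] , λ ()
euler-tour {suc n} z conn even d≢0
  -- The nonzero degree of `zero` supplies the first closed walk to extend.
  with l , z′ , z≋ , even′ ← closed-walk zero z even (d≢0 zero)
  = hierholzer {z = z} conn {zero} (zero ∷ l) (here refl) z′ (<-wellFounded (size z′)) z≋ even′

-- Working from the right, `once` keeps the last occurrence of each vertex and `rest` takes the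
-- others. Both preserve the order of l, as shortcutting requires.
split-tour : (l : List (Fin n)) → ∃₂ λ once rest →
  Unique once × once ⊆ l × rest ⊆ l × (∀ {v} → v ∈ l → v ∈ once) ×
  (∀ v → visits v l ≡ visits v once ℕ.+ visits v rest)
split-tour [] = [] , [] , [] , [] , [] , (λ ()) , λ _ → refl
split-tour (x ∷ l) with split-tour l
... | once , rest , uniq , once⊆ , rest⊆ , ∈once , count with Mem._∈?_ _≟_ x once
... | yes x∈once = once , x ∷ rest , uniq , x ∷ʳ once⊆ , refl ∷ rest⊆ ,
  (λ { (here refl) → x∈once ; (there v∈l) → ∈once v∈l }) ,
  λ v → trans (cong (δ x v ℕ.+_) (count v)) (x∙yz≈y∙xz (δ x v) (visits v once) (visits v rest))
... | no x∉once = x ∷ once , rest , ¬Any⇒All¬ once x∉once ∷ uniq , refl ∷ once⊆ , x ∷ʳ rest⊆ ,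
  (λ { (here refl) → here refl ; (there v∈l) → there (∈once v∈l) }) ,
  λ v → trans (cong (δ x v ℕ.+_) (count v)) (sym (+-assoc (δ x v) (visits v once) (visits v rest)))

-- Degrees and connectivity of Hamiltonian cycles.

walk-reaches : {z : Multigraph n} (s t : Fin n) (l : List (Fin n)) →
  (∀ u v → mult (fromEdges (walkEdges (s ∷ l) t)) u v ℕ.≤ mult z u v) →
  ∀ {v} → v ∈ l → Star (Adjacent z) s v
walk-reaches {z = z} s t (x ∷ l) ≤z v∈xl = s~x ◅ next v∈xl
  where
  s~x : Adjacent z s x
  s~x = ≤-trans (subst (0 <_) (sym (trans (fromEdges-++ [ s , x ] (walkEdges (x ∷ l) t) s x)
                  (cong (ℕ._+ mult (fromEdges (walkEdges (x ∷ l) t)) s x) (mult-edge-yes s x (inj₁ (refl , refl))))))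
                  (s≤s z≤n)) (≤z s x)
  next : ∀ {v} → v ∈ x ∷ l → Star (Adjacent z) x v
  next (here refl) = ε
  -- Containment in z, unlike equality with z, passes to the tail of the walk.
  next (there v∈l) = walk-reaches {z = z} x t l
    (λ u v → ≤-trans (subst (mult (fromEdges (walkEdges (x ∷ l) t)) u v ℕ.≤_)
                        (sym (fromEdges-++ [ s , x ] (walkEdges (x ∷ l) t) u v)) (m≤n+m _ _))
                     (≤z u v)) v∈l

hamiltonian-degree : {z : Multigraph n} → IsHamiltonianCycle z → ∀ v → degree z v ≡ 2
hamiltonian-degree {z = z} (l , uniq , all∈ , z≡) v = trans (degree-cong {z = z} {fromEdges (cyclicEdges l)} z≡ v)
  (trans (degree-cyclic l v) (cong (2 ℕ.*_) (visits-unique uniq (all∈ v))))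

hamiltonian-connected : {z : Multigraph n} → IsHamiltonianCycle z → Connected z
hamiltonian-connected {z = z} ([] , uniq , all∈ , z≡) u v with () ← all∈ u
hamiltonian-connected {z = z} (x ∷ l , uniq , all∈ , z≡) u v =
  -- Both vertices are reached from the head x of the cycle, and the path to u is reversed.
  reverse (λ {a} {b} → subst (0 <_) (mult-sym z a b)) (from-x (all∈ u)) ◅◅ from-x (all∈ v)
  where
  from-x : ∀ {v} → v ∈ x ∷ l → Star (Adjacent z) x v
  from-x (here refl) = ε
  from-x (there v∈l) = walk-reaches {z = z} x x l
    (λ a b → ≤-reflexive (sym (subst (λ es → mult z a b ≡ mult (fromEdges es) a b) (cyclicEdges-∷ x l) (z≡ a b)))) v∈l

-- Order on the ring of costs.

module _ {a ℓ₁ ℓ₂ : Level} (K : OrderedCommutativeRing a ℓ₁ ℓ₂) where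
  private module R = OrderedCommutativeRing K
  open R using (_≤_; _+_; _*_; -_; 0#; +-mono-≤)

  poset : Poset a ℓ₁ ℓ₂
  poset = record { isPartialOrder = R.isPartialOrder }

  open Poset poset using () renaming (refl to ≤ᴷ-refl)
  open import Relation.Binary.Reasoning.PartialOrder poset

  -- The nonnegative product of x and z - y is added to xy.
  *-monoʳ-≤-nonNeg : ∀ {x y z} → 0# ≤ x → y ≤ z → x * y ≤ x * z
  *-monoʳ-≤-nonNeg {x} {y} {z} 0≤x y≤z = begin
    x * y                  ≈⟨ R.+-identityˡ (x * y) ⟨
    0# + x * y             ≤⟨ +-mono-≤ (R.*-nonNegative 0≤x 0≤z-y) ≤ᴷ-refl ⟩
    x * (z + - y) + x * y  ≈⟨ R.distribˡ x (z + - y) y ⟨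
    x * (z + - y + y)      ≈⟨ R.*-congˡ (begin-equality
      z + - y + y            ≈⟨ R.+-assoc z (- y) y ⟩
      z + (- y + y)          ≈⟨ R.+-congˡ (R.-‿inverseˡ y) ⟩
      z + 0#                 ≈⟨ R.+-identityʳ z ⟩
      z                      ∎) ⟩
    x * z                  ∎
    where
    0≤z-y : 0# ≤ z + - y
    0≤z-y = begin
      0#       ≈⟨ R.-‿inverseʳ y ⟨
      y + - y  ≤⟨ +-mono-≤ y≤z ≤ᴷ-refl ⟩
      z + - y  ∎

-- Additivity of the cost, and the cost of an edge.

module _ {a ℓ₁ ℓ₂ : Level} {K : OrderedCommutativeRing a ℓ₁ ℓ₂} {n : ℕ} (c : MetricCost K n) where
  private module R = OrderedCommutativeRing K
  open R using (Carrier; _≈_; _≤_; _+_; 0#; +-monoid; +-commutativeMonoid; +-mono-≤)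
  open MetricCost c
  open Sum +-commutativeMonoid using (sum-cong-≋) renaming (∑-distrib-+ to ∑ᴷ-distrib-+)
  open Mult +-monoid using (×-congˡ; ×-homo-+; ×-homo-1) renaming (_×_ to _·_)
  open import Relation.Binary.Reasoning.PartialOrder (poset K)
  private module P = Poset (poset K)

  private
    if-does : {A : Set} (a? : Dec A) {x y w : Carrier} → (A → x ≈ w) → (¬ A → y ≈ w) →
      (if does a? then x else y) ≈ w
    if-does (yes a) x≈w y≈w = x≈w a
    if-does (no ¬a) x≈w y≈w = y≈w ¬a

  cost-cong : {z z′ : Multigraph n} → z ≋ z′ → cost c z ≈ cost c z′
  cost-cong {z} {z′} z≋ = sum-cong-≋ λ u → sum-cong-≋ λ v → term u v (does (u ≤? v))
    where
    term : ∀ u v b →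
      (if b then mult z u v · edgeCost u v else 0#) ≈ (if b then mult z′ u v · edgeCost u v else 0#)
    term u v true  = ×-congˡ (z≋ u v)
    term u v false = R.refl

  cost-⊕ : (z z′ : Multigraph n) → cost c (z ⊕ z′) ≈ cost c z + cost c z′
  cost-⊕ z z′ = R.trans
    (sum-cong-≋ λ u → R.trans
      (sum-cong-≋ λ v → term u v (does (u ≤? v)))
      (∑ᴷ-distrib-+ (t z u) (t z′ u)))
    (∑ᴷ-distrib-+ (λ u → Sum.sum +-commutativeMonoid (t z u)) (λ u → Sum.sum +-commutativeMonoid (t z′ u)))
    where
    t : Multigraph n → Fin n → Fin n → Carrier
    t z u v = if does (u ≤? v) then mult z u v · edgeCost u v else 0#
    term : ∀ u v b →
      (if b then (mult z u v ℕ.+ mult z′ u v) · edgeCost u v else 0#) ≈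
      (if b then mult z u v · edgeCost u v else 0#) + (if b then mult z′ u v · edgeCost u v else 0#)
    term u v true  = ×-homo-+ (edgeCost u v) (mult z u v) (mult z′ u v)
    term u v false = R.sym (R.+-identityˡ 0#)

  private
    -- `cost` reads each edge at its ordered representative only, here (x , y); by antisymmetry the
    -- reversed pair is counted only if x and y coincide.
    cost-edge-≤ : {x y : Fin n} → x ≤ᶠ y → cost c (edge x y) ≈ edgeCost x y
    cost-edge-≤ {x} {y} x≤y = R.trans
      (sum-single +-commutativeMonoid (λ u → Sum.sum +-commutativeMonoid (t u)) x λ u u≢x →
        sum-zero +-commutativeMonoid (t u) λ v → zero-term u v λ
          { u≤v (inj₁ (u≡x , _))     → u≢x u≡x
          ; u≤v (inj₂ (refl , refl)) → u≢x (≤ᶠ-antisym u≤v x≤y) })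
      (R.trans (sum-single +-commutativeMonoid (t x) y λ v v≢y → zero-term x v λ
          { _ (inj₁ (_ , v≡y))    → v≢y v≡y
          ; _ (inj₂ (refl , x≡y)) → v≢y x≡y })
        one-term)
      where
      t : Fin n → Fin n → Carrier
      t u v = if does (u ≤? v) then mult (edge x y) u v · edgeCost u v else 0#
      zero-term : ∀ u v → (u ≤ᶠ v → ¬ SameEdge (u , v) (x , y)) → t u v ≈ 0#
      zero-term u v ¬same = if-does (u ≤? v)
        (λ u≤v → ×-congˡ {edgeCost u v} (mult-edge-no u v (¬same u≤v))) (λ _ → R.refl)
      one-term : t x y ≈ edgeCost x y
      one-term = if-does (x ≤? y)
        (λ _ → R.trans (×-congˡ {edgeCost x y} (mult-edge-yes x y (inj₁ (refl , refl)))) (×-homo-1 (edgeCost x y)))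
        (contradiction x≤y)

  cost-edge : (x y : Fin n) → cost c (edge x y) ≈ edgeCost x y
  cost-edge x y with ≤ᶠ-total x y
  ... | inj₁ x≤y = cost-edge-≤ x≤y
  ... | inj₂ y≤x = R.trans (cost-cong {edge x y} {edge y x} flip) (R.trans (cost-edge-≤ y≤x) (symmetric y x))
    where
    swap-ends : ∀ {u v x y : Fin n} → SameEdge (u , v) (y , x) → SameEdge (u , v) (x , y)
    swap-ends (inj₁ (p , q)) = inj₂ (q , p)
    swap-ends (inj₂ (p , q)) = inj₁ (q , p)
    flip : edge x y ≋ edge y x
    flip u v with sameEdge? (u , v) (y , x)
    ... | yes same = trans (mult-edge-yes u v (swap-ends {u} {v} same)) (sym (mult-edge-yes u v same))
    ... | no ¬same = trans (mult-edge-no u v (¬same ∘ swap-ends {u} {v})) (sym (mult-edge-no u v ¬same))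

  -- Costs of tours and shortcutting.

  pathCost : Fin n → List (Fin n) → Fin n → Carrier
  pathCost s []      t = edgeCost s t
  pathCost s (x ∷ l) t = edgeCost s x + pathCost x l t

  tourCost : List (Fin n) → Carrier
  tourCost []      = 0#
  tourCost (x ∷ l) = pathCost x l x

  cost-walk : (s : Fin n) (l : List (Fin n)) (t : Fin n) →
    cost c (fromEdges (walkEdges (s ∷ l) t)) ≈ pathCost s l t
  cost-walk s []      t = cost-edge s t
  cost-walk s (x ∷ l) t = R.trans
    (cost-cong {fromEdges (walkEdges (s ∷ x ∷ l) t)} {edge s x ⊕ fromEdges (walkEdges (x ∷ l) t)}
      (fromEdges-++ [ s , x ] (walkEdges (x ∷ l) t)))
    (R.trans (cost-⊕ (edge s x) (fromEdges (walkEdges (x ∷ l) t))) (R.+-cong (cost-edge s x) (cost-walk x l t)))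

  cost-cyclic : (l : List (Fin n)) → cost c (fromEdges (cyclicEdges l)) ≈ tourCost l
  cost-cyclic []      = sum-zero +-commutativeMonoid {n} _ λ u → sum-zero +-commutativeMonoid {n} _ λ v →
    if-does (u ≤? v) (λ _ → R.refl) (λ _ → R.refl)
  cost-cyclic (x ∷ l) rewrite cyclicEdges-∷ x l = cost-walk x l x

  pathCost-shortcut : (s y : Fin n) (l : List (Fin n)) (t : Fin n) → pathCost s l t ≤ edgeCost s y + pathCost y l t
  pathCost-shortcut s y []      t = triangle s y t
  pathCost-shortcut s y (x ∷ l) t = begin
    edgeCost s x + pathCost x l t                   ≤⟨ +-mono-≤ (triangle s y x) P.refl ⟩
    edgeCost s y + edgeCost y x + pathCost x l t    ≈⟨ R.+-assoc _ _ _ ⟩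
    edgeCost s y + (edgeCost y x + pathCost x l t)  ∎

  pathCost-shortcutʳ : (s : Fin n) (l : List (Fin n)) (t y : Fin n) → pathCost s l y ≤ pathCost s l t + edgeCost t y
  pathCost-shortcutʳ s []      t y = triangle s t y
  pathCost-shortcutʳ s (x ∷ l) t y = begin
    edgeCost s x + pathCost x l y                   ≤⟨ +-mono-≤ P.refl (pathCost-shortcutʳ x l t y) ⟩
    edgeCost s x + (pathCost x l t + edgeCost t y)  ≈⟨ R.+-assoc _ _ _ ⟨
    edgeCost s x + pathCost x l t + edgeCost t y    ∎

  -- Inner vertices are dropped one at a time, each by a triangle inequality; the ends lie outside
  -- the lists and stay fixed.
  pathCost-⊆ : {l m : List (Fin n)} → l ⊆ m → ∀ s t → pathCost s l t ≤ pathCost s m t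
  pathCost-⊆ []                     s t = P.refl
  pathCost-⊆ {l} {y ∷ m} (y ∷ʳ l⊆m) s t = P.trans (pathCost-⊆ l⊆m s t) (pathCost-shortcut s y m t)
  pathCost-⊆ {x ∷ l} (refl ∷ l⊆m)   s t = +-mono-≤ P.refl (pathCost-⊆ l⊆m x t)

  tourCost-∷ : (y : Fin n) (l : List (Fin n)) → tourCost l ≤ tourCost (y ∷ l)
  -- Here the whole tour is the self-loop at y, and dropping y leaves cost 0.
  tourCost-∷ y []      = nonNegative y y
  tourCost-∷ y (x ∷ l) = begin
    pathCost x l x                 ≤⟨ pathCost-shortcutʳ x l y x ⟩
    pathCost x l y + edgeCost y x  ≈⟨ R.+-comm _ _ ⟩
    edgeCost y x + pathCost x l y  ∎

  tourCost-⊆ : {l m : List (Fin n)} → l ⊆ m → tourCost l ≤ tourCost m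
  tourCost-⊆ []                    = P.refl
  tourCost-⊆ {l} {y ∷ m} (y ∷ʳ l⊆m) = P.trans (tourCost-⊆ l⊆m) (tourCost-∷ y m)
  -- The first kept head is a common base point, so both tours become paths from x to x.
  tourCost-⊆ {x ∷ l} (refl ∷ l⊆m)   = pathCost-⊆ l⊆m x x

  -- Splitting a many-visits tour.

  tour-splits : (r : Fin n → ℕ) → (∀ v → 1 ℕ.≤ r v) → {z : Multigraph n} → IsManyVisitsTour r z →
    ∃₂ λ h p → IsHamiltonianCycle h × IsTransportation (λ v → r v ∸ 1) p ×
    cost c h ≤ cost c z × cost c p ≤ cost c z
  tour-splits r r≥1 {z} (deg , conn)
    with l , z≋ ← euler-tour z conn (λ v → subst (2 ∣_) (sym (deg v)) (m∣m*n (r v)))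
                    (λ v d≡0 → n>0⇒n≢0 (r≥1 v) (m+n≡0⇒m≡0 (r v) (trans (sym (deg v)) d≡0)))
    with once , rest , uniq , once⊆ , rest⊆ , ∈once , count ← split-tour l
    = fromEdges (cyclicEdges once) , fromEdges (cyclicEdges rest)
    , (once , uniq , all∈once , λ _ _ → refl)
    , (λ v → trans (degree-cyclic rest v) (cong (2 ℕ.*_) (rest-visits v)))
    , bound once once⊆ , bound rest rest⊆
    where
    visits≡r : ∀ v → visits v l ≡ r v
    visits≡r v = *-cancelˡ-≡ _ _ 2 (trans (sym (degree-cyclic l v))
      (trans (sym (degree-cong {z = z} {fromEdges (cyclicEdges l)} z≋ v)) (deg v)))
    all∈once : ∀ v → v ∈ once
    all∈once v = ∈once (decidable-stable (Mem._∈?_ _≟_ v l) λ v∉l →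
      n>0⇒n≢0 (r≥1 v) (trans (sym (visits≡r v)) (visits-∉ l v∉l)))
    rest-visits : ∀ v → visits v rest ≡ r v ∸ 1
    rest-visits v = sym (cong (_∸ 1) (trans (sym (visits≡r v))
      (trans (count v) (cong (ℕ._+ visits v rest) (visits-unique uniq (all∈once v))))))
    bound : ∀ m → m ⊆ l → cost c (fromEdges (cyclicEdges m)) ≤ cost c z
    bound m m⊆l = begin
      cost c (fromEdges (cyclicEdges m))  ≈⟨ cost-cyclic m ⟩
      tourCost m                          ≤⟨ tourCost-⊆ m⊆l ⟩
      tourCost l                          ≈⟨ cost-cyclic l ⟨
      cost c (fromEdges (cyclicEdges l))  ≈⟨ cost-cong {z} {fromEdges (cyclicEdges l)} z≋ ⟨
      cost c z                            ∎

theorem5 : {a ℓ₁ ℓ₂ : Level} (K : OrderedCommutativeRing a ℓ₁ ℓ₂) →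
    let open OrderedCommutativeRing K in
    (n : ℕ) (c : MetricCost K n) (r : Fin n → ℕ) → (∀ v → 1 ℕ.≤ r v) →
    (α : Carrier) → 1# ≤ α →
    (OPT₁ T₁ P OPTᵣ : Multigraph n) →
    IsOptimal c IsHamiltonianCycle OPT₁ →
    IsHamiltonianCycle T₁ → cost c T₁ ≤ α * cost c OPT₁ →
    IsOptimal c (IsTransportation (λ v → r v ∸ 1)) P →
    IsOptimal c (IsManyVisitsTour r) OPTᵣ →
    IsManyVisitsTour r (T₁ ⊕ P) × cost c (T₁ ⊕ P) ≤ (α + 1#) * cost c OPTᵣ
theorem5 K n c r r≥1 α 1≤α OPT₁ T₁ P OPTᵣ (_ , OPT₁-min) T₁-ham T₁≤ (P-transp , P-min) (OPTᵣ-tour , _)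
  with h , p , h-ham , p-transp , h≤ , p≤ ← tour-splits c r r≥1 {OPTᵣ} OPTᵣ-tour
  = (degrees , connected) , bound
  where
  open OrderedCommutativeRing K using (_+_; _*_; _≤_; 1#; 0≤1; +-mono-≤; +-congˡ; distribʳ; *-identityˡ)
  open Poset (poset K) using () renaming (trans to ≤ᴷ-trans)
  open import Relation.Binary.Reasoning.PartialOrder (poset K)
  degrees : ∀ v → degree (T₁ ⊕ P) v ≡ 2 ℕ.* r v
  degrees v = trans (degree-⊕ T₁ P v) (trans
    (cong₂ ℕ._+_ (hamiltonian-degree {z = T₁} T₁-ham v) (P-transp v))
    -- Since r v is at least 1, the truncated `r v ∸ 1` is exact, and the cycle's degree 2 restores
    -- the missing visit.
    (trans (sym (*-distribˡ-+ 2 1 (r v ∸ 1))) (cong (2 ℕ.*_) (m+[n∸m]≡n (r≥1 v)))))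
  connected : Connected (T₁ ⊕ P)
  connected u v = mapStar (λ {x} {y} xy → ≤-trans xy (m≤m+n (mult T₁ x y) (mult P x y)))
    (hamiltonian-connected {z = T₁} T₁-ham u v)
  bound : cost c (T₁ ⊕ P) ≤ (α + 1#) * cost c OPTᵣ
  bound = begin
    cost c (T₁ ⊕ P)                     ≈⟨ cost-⊕ c T₁ P ⟩
    cost c T₁ + cost c P                ≤⟨ +-mono-≤
      -- The cycle `h` links `OPT₁` to `OPTᵣ`; multiplying by α keeps the order because 0 ≤ 1 ≤ α.
      (≤ᴷ-trans T₁≤ (*-monoʳ-≤-nonNeg K (≤ᴷ-trans 0≤1 1≤α) (≤ᴷ-trans (OPT₁-min h h-ham) h≤)))
      (≤ᴷ-trans (P-min p p-transp) p≤) ⟩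
    α * cost c OPTᵣ + cost c OPTᵣ       ≈⟨ +-congˡ (*-identityˡ _) ⟨
    α * cost c OPTᵣ + 1# * cost c OPTᵣ  ≈⟨ distribʳ _ _ _ ⟨
    (α + 1#) * cost c OPTᵣ              ∎
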